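{- Let $G$ be a modulo transmission irregular graph and let $H$ be a connected graph such that $|V(G)|$ and $|V(H)|$ are relatively prime. Then: (i) if $H$ is transmission irregular, then the Cartesian product $G\square H$ is transmission irregular; (ii) if $H$ is modulo transmission irregular, then $G\square H$ is modulo transmission irregular.
   Context: For a connected graph $X$, $Tr_X(x)=\sum_{y\in V(X)}d_X(x,y)$ is the transmission of vertex $x$. A connected graph is transmission irregular (TI) if no two vertices have equal transmissions, and modulo transmission irregular (MTI) if no two distinct vertices have transmissions congruent modulo the number of vertices of the graph. The Cartesian product $G\square H$ has vertex set $V(G)\times V(H)$, with $(u_G,u_H)$ adjacent to $(v_G,v_H)$ iff either $u_G=v_G$ and $u_Hv_H\in E(H)$, or $u_Gv_G\in E(G)$ and $u_H=v_H$. -}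

module Defs where

open import Algebra.Properties.Semiring.Sum using (sum)
open import Data.Fin.Base using (Fin)
open import Data.Fin.Properties using (any?; inj⇒≟; *↔×)
open import Data.Nat.Base using (ℕ; zero; suc; _*_; _≤_; z≤n; s≤s; ∣_-_∣)
open import Data.Nat.Divisibility using (_∣_)
open import Data.Nat.Properties using (+-*-semiring)
open import Data.Product.Base using (Σ-syntax; ∃-syntax; _×_; _,_; proj₁; proj₂)
open import Data.Product.Function.NonDependent.Propositional using (_×-↔_)
open import Data.Sum.Base using (_⊎_; inj₁; inj₂)
open import Function.Base using (_∘_)
open import Function.Bundles using (Inverse; _↔_)
open import Function.Construct.Composition using (_↔-∘_)
open import Function.Construct.Symmetry using (↔-sym)
open import Function.Properties.Inverse using (↔⇒↣)
open import Relation.Binary.Definitions using (Decidable; DecidableEquality; Symmetric)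
open import Relation.Binary.PropositionalEquality.Core using (_≡_; _≢_; refl; sym; subst)
open import Relation.Nullary.Decidable.Core using (Dec; yes; no; map′; _×-dec_; _⊎-dec_)
open import Relation.Nullary.Negation.Core using (¬_; contradiction)
import Relation.Unary as U

-- Finite simple graphs; decidable adjacency makes distances computable.
record Graph : Set₁ where
  infix 4 _~_ _~?_
  field
    Vertex   : Set
    order    : ℕ
    enum     : Vertex ↔ Fin order
    _~_      : Vertex → Vertex → Set
    _~?_     : Decidable _~_
    ~-sym    : Symmetric _~_
    ~-irrefl : ∀ {u} → ¬ (u ~ u)

  index : Vertex → Fin order
  index = Inverse.to enum

  vertex : Fin order → Vertex
  vertex = Inverse.from enum

  _≟_ : DecidableEquality Vertex
  _≟_ = inj⇒≟ (↔⇒↣ enum)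

  data Walk : ℕ → Vertex → Vertex → Set where
    []  : ∀ {u} → Walk zero u u
    _∷_ : ∀ {k u v w} → u ~ v → Walk k v w → Walk (suc k) u w

  Connected : Set
  Connected = ∀ u v → ∃[ k ] Walk k u v

  IsDistance : Vertex → Vertex → ℕ → Set
  IsDistance u v k = Walk k u v × (∀ {j} → Walk j u v → k ≤ j)

  any-vertex? : {P : Vertex → Set} → U.Decidable P → Dec (∃[ v ] P v)
  any-vertex? {P} P? = map′
    (λ (i , p) → vertex i , p)
    (λ (v , p) → index v , subst P (sym (Inverse.strictlyInverseʳ enum v)) p)
    (any? (P? ∘ vertex))

  walk? : ∀ k → Decidable (Walk k)
  walk? zero u v = map′ (λ { refl → [] }) (λ { [] → refl }) (u ≟ v)
  walk? (suc k) u w = map′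
    (λ (_ , a , p) → a ∷ p)
    (λ { (a ∷ p) → _ , a , p })
    (any-vertex? (λ v → (u ~? v) ×-dec walk? k v w))

open Graph public using (Vertex; order; Connected)

least : {P : ℕ → Set} → U.Decidable P → ∀ n → P n →
        ∃[ k ] (P k × (∀ {j} → P j → k ≤ j))
least P? zero p = zero , p , λ _ → z≤n
least {P} P? (suc n) p with P? zero
... | yes p₀ = zero , p₀ , λ _ → z≤n
... | no ¬p₀ with least (P? ∘ suc) n p
...   | k , q , k-least = suc k , q , minimal
  where
  minimal : ∀ {j} → P j → suc k ≤ j
  minimal {zero}  r = contradiction r ¬p₀
  minimal {suc j} r = s≤s (k-least r)

-- The connectedness proof only bounds the search: by the minimality in
-- IsDistance, the resulting number does not depend on it.
distance : (X : Graph) → Connected X → ∀ u v → ∃[ k ] Graph.IsDistance X u v k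
distance X c u v =
  least (λ k → Graph.walk? X k u v) (proj₁ (c u v)) (proj₂ (c u v))

d : (X : Graph) → Connected X → Vertex X → Vertex X → ℕ
d X c u v = proj₁ (distance X c u v)

Tr : (X : Graph) → Connected X → Vertex X → ℕ
Tr X c u = sum +-*-semiring (λ i → d X c u (Graph.vertex X i))

infix 4 _≡_[mod_]
_≡_[mod_] : ℕ → ℕ → ℕ → Set
a ≡ b [mod n ] = n ∣ ∣ a - b ∣

TransmissionIrregular : Graph → Set
TransmissionIrregular X =
  Σ[ c ∈ Connected X ] (∀ u v → u ≢ v → Tr X c u ≢ Tr X c v)

ModuloTransmissionIrregular : Graph → Set
ModuloTransmissionIrregular X =
  Σ[ c ∈ Connected X ] (∀ u v → u ≢ v → ¬ (Tr X c u ≡ Tr X c v [mod order X ]))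

infixr 7 _□_
_□_ : Graph → Graph → Graph
G □ H = record
  { Vertex   = G.Vertex × H.Vertex
  ; order    = G.order * H.order
  ; enum     = ↔-sym *↔× ↔-∘ (G.enum ×-↔ H.enum)
  ; _~_      = λ (u , x) (v , y) → (u ≡ v × x H.~ y) ⊎ (u G.~ v × x ≡ y)
  ; _~?_     = λ (u , x) (v , y) →
                 ((u G.≟ v) ×-dec (x H.~? y)) ⊎-dec ((u G.~? v) ×-dec (x H.≟ y))
  ; ~-sym    = λ { (inj₁ (p , a)) → inj₁ (sym p , H.~-sym a)
                 ; (inj₂ (a , p)) → inj₂ (G.~-sym a , sym p) }
  ; ~-irrefl = λ { (inj₁ (_ , a)) → H.~-irrefl a
                 ; (inj₂ (a , _)) → G.~-irrefl a }
  }
  where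
  module G = Graph G
  module H = Graph H

{-# OPTIONS --safe #-}

-- Distances add up along the two coordinates of a Cartesian product, so
--   Tr (u , x) = |H| · Tr u + |G| · Tr x.
-- Modulo |G| only |H| · Tr u survives and |H| is invertible, so the transmission
-- of (u , x) modulo |G| determines Tr u modulo |G|, hence u.  Once u is known,
-- Tr x is recovered by cancelling |G|; symmetrically, the transmission of
-- (u , x) modulo |H| determines Tr x modulo |H|.
module Submission where

open import Defs
open import Data.Fin.Base using (Fin; zero; suc; combine; remQuot; _↑ˡ_; _↑ʳ_)
open import Data.Fin.Properties using (nonZeroIndex; remQuot-combine)
open import Data.Nat.Base using (ℕ; zero; suc; _+_; _*_; _≤_; NonZero)
open import Data.Nat.Coprimality using (Coprime; coprime-divisor) renaming (sym to coprime-sym)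
open import Data.Nat.Divisibility using (_∣_; _∣0; ∣-trans; ∣m+n∣m⇒∣n; ∣m∸n∣n⇒∣m; m∣m*n; n∣m*n)
open import Data.Nat.Properties
  using (+-*-semiring; +-assoc; +-comm; +-suc; +-cancelˡ-≡; +-mono-≤; *-cancelˡ-≡; *-distribˡ-∣-∣;
         ≤-antisym; ≤-total; m∸n+n≡m; m≤n⇒∣m-n∣≡n∸m; m≤n⇒∣n-m∣≡n∸m; m≡n⇒∣m-n∣≡0; ∣-∣-comm)
open import Data.Product.Base using (∃₂; _×_; _,_; proj₁; proj₂)
open import Data.Sum.Base using (inj₁; inj₂)
open import Function.Base using (_∘_)
open import Relation.Binary.PropositionalEquality
  using (_≡_; _≢_; refl; sym; trans; cong; cong₂; subst; subst₂; module ≡-Reasoning)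
open import Relation.Nullary.Decidable.Core using (decidable-stable)

open import Algebra.Properties.Semiring.Sum +-*-semiring
  using (sum; sum-cong-≗; ∑-distrib-+; *-distribˡ-sum)

sum-const : ∀ n x → sum {n} (λ _ → x) ≡ n * x
sum-const zero    x = refl
sum-const (suc n) x = cong (x +_) (sum-const n x)

sum-++ : ∀ m {n} (f : Fin (m + n) → ℕ) → sum f ≡ sum (f ∘ (_↑ˡ n)) + sum (f ∘ (m ↑ʳ_))
sum-++ zero    f = refl
sum-++ (suc m) f = trans (cong (f zero +_) (sum-++ m (f ∘ suc))) (sym (+-assoc (f zero) _ _))

-- `combine` numbers pairs row by row: the first `n` indices form the row `i = 0`, and the induction
-- hypothesis covers the other rows.
sum-combine : ∀ m {n} (f : Fin (m * n) → ℕ) → sum f ≡ sum (λ i → sum (λ j → f (combine {m} i j)))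
sum-combine zero        f = refl
sum-combine (suc m) {n} f = trans (sum-++ n f)
  (cong (sum (f ∘ (_↑ˡ (m * n))) +_) (sum-combine m (f ∘ (n ↑ʳ_))))

-- The enumeration of `G □ H` decodes an index by `remQuot`, so this turns a transmission in the
-- product into a double sum over the factors.
sum-remQuot : ∀ m {n} (f : Fin m × Fin n → ℕ) →
              sum (f ∘ remQuot {m} n) ≡ sum (λ i → sum (λ j → f (i , j)))
sum-remQuot m f = trans (sum-combine m _)
  (sum-cong-≗ {m} λ i → sum-cong-≗ λ j → cong f (remQuot-combine i j))

-- Each `f i` is counted `n` times and each `g j` is counted `m` times; hence the crossed orders in
-- `Tr-□`.
sum-⊕ : ∀ {m n} (f : Fin m → ℕ) (g : Fin n → ℕ) →
        sum (λ i → sum (λ j → f i + g j)) ≡ n * sum f + m * sum g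
sum-⊕ {m} {n} f g = begin
  sum (λ i → sum (λ j → f i + g j))         ≡⟨ sum-cong-≗ (λ i → ∑-distrib-+ (λ _ → f i) g) ⟩
  sum (λ i → sum {n} (λ _ → f i) + sum g)   ≡⟨ sum-cong-≗ (λ i → cong (_+ sum g) (sum-const n (f i))) ⟩
  sum (λ i → n * f i + sum g)               ≡⟨ ∑-distrib-+ (λ i → n * f i) (λ _ → sum g) ⟩
  sum (λ i → n * f i) + sum {m} (λ _ → sum g)
    ≡⟨ cong₂ _+_ (sym (*-distribˡ-sum n f)) (sum-const m (sum g)) ⟩
  n * sum f + m * sum g                     ∎
  where open ≡-Reasoning

≡0[mod]-resp : ∀ {k m n} → k ∣ m → m ≡ n [mod k ] → k ∣ n
≡0[mod]-resp {k} {m} {n} k∣m m≡n with ≤-total m n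
... | inj₁ m≤n = ∣m∸n∣n⇒∣m k m≤n (subst (k ∣_) (m≤n⇒∣m-n∣≡n∸m m≤n) m≡n) k∣m
... | inj₂ n≤m = ∣m+n∣m⇒∣n (subst (k ∣_) (sym (m∸n+n≡m n≤m)) k∣m)
                            (subst (k ∣_) (m≤n⇒∣n-m∣≡n∸m n≤m) m≡n)

mod-sym : ∀ {k} m n → m ≡ n [mod k ] → n ≡ m [mod k ]
mod-sym {k} m n = subst (k ∣_) (∣-∣-comm m n)

mod-reflexive : ∀ {k m n} → m ≡ n → m ≡ n [mod k ]
mod-reflexive {k} m≡n = subst (k ∣_) (sym (m≡n⇒∣m-n∣≡0 m≡n)) (k ∣0)

-- Congruence is divisibility of an absolute difference, which is unchanged when both arguments lose
-- a successor. Descending until `m` or `n` is zero leaves a multiple of `k` on one side, so the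
-- other side is one too.
mod-+-cancelʳ : ∀ {k p q} m n → k ∣ p → k ∣ q → m + p ≡ n + q [mod k ] → m ≡ n [mod k ]
mod-+-cancelʳ {k} {p} {q} zero n k∣p k∣q eq =
  ∣m+n∣m⇒∣n (subst (k ∣_) (+-comm n q) (≡0[mod]-resp k∣p eq)) k∣q
mod-+-cancelʳ {k} {p} {q} (suc m) zero k∣p k∣q eq =
  ∣m+n∣m⇒∣n (subst (k ∣_) (+-comm (suc m) p) (≡0[mod]-resp k∣q (mod-sym (suc m + p) q eq))) k∣p
mod-+-cancelʳ (suc m) (suc n) k∣p k∣q eq = mod-+-cancelʳ m n k∣p k∣q eq

mod-*-cancelˡ : ∀ {k l} m n → Coprime k l → l * m ≡ l * n [mod k ] → m ≡ n [mod k ]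
mod-*-cancelˡ {k} {l} m n k⊥l eq =
  coprime-divisor k⊥l (subst (k ∣_) (sym (*-distribˡ-∣-∣ l m n)) eq)

-- The multiples of `k` vanish, and coprimality cancels `l`. The two orders are used here in either
-- role.
mod-linear : ∀ {k l a a′ b b′} → Coprime k l →
             l * a + k * b ≡ l * a′ + k * b′ [mod k ] → a ≡ a′ [mod k ]
mod-linear {k} {l} {a} {a′} {b} {b′} k⊥l =
  mod-*-cancelˡ a a′ k⊥l ∘ mod-+-cancelʳ (l * a) (l * a′) (m∣m*n b) (m∣m*n b′)

-- Identifies the number found by the search in `distance` with any number shown to be a distance,
-- whichever connectedness proof bounded the search.
IsDistance-unique : ∀ X {u v j k} → Graph.IsDistance X u v j → Graph.IsDistance X u v k → j ≡ k
IsDistance-unique X (p , p-least) (q , q-least) = ≤-antisym (p-least q) (q-least p)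

module _ (G H : Graph) where
  private
    module G = Graph G
    module H = Graph H
    module P = Graph (G □ H)

  inject₂ : ∀ {u l x y} → H.Walk l x y → P.Walk l (u , x) (u , y)
  inject₂ H.[]      = P.[]
  inject₂ (a H.∷ q) = inj₁ (refl , a) P.∷ inject₂ q

  product-walk : ∀ {k l u v x y} → G.Walk k u v → H.Walk l x y → P.Walk (k + l) (u , x) (v , y)
  product-walk G.[]      q = inject₂ q
  product-walk (a G.∷ p) q = inj₂ (a , refl) P.∷ product-walk p q

  -- Every step moves exactly one coordinate, so sorting the steps by coordinate splits the walk
  -- without loss of length.
  project-walk : ∀ {n u v x y} → P.Walk n (u , x) (v , y) →
                 ∃₂ λ k l → G.Walk k u v × H.Walk l x y × k + l ≡ n
  project-walk P.[] = 0 , 0 , G.[] , H.[] , refl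
  project-walk (inj₁ (refl , a) P.∷ w) with k , l , p , q , refl ← project-walk w =
    k , suc l , p , a H.∷ q , +-suc k l
  project-walk (inj₂ (a , refl) P.∷ w) with k , l , p , q , refl ← project-walk w =
    suc k , l , a G.∷ p , q , refl

  □-connected : Connected G → Connected H → Connected (G □ H)
  □-connected cG cH (u , x) (v , y) = _ , product-walk (proj₂ (cG u v)) (proj₂ (cH x y))

  □-IsDistance : ∀ {u v x y k l} → G.IsDistance u v k → H.IsDistance x y l →
                 P.IsDistance (u , x) (v , y) (k + l)
  □-IsDistance {k = k} {l} (p , p-least) (q , q-least) = product-walk p q , minimal
    where
    minimal : ∀ {n} → P.Walk n _ _ → k + l ≤ n
    -- The projections of a walk are at least as long as the distances in the factors.
    minimal w with _ , _ , p′ , q′ , refl ← project-walk w = +-mono-≤ (p-least p′) (q-least q′)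

  module _ (cG : Connected G) (cH : Connected H) (c : Connected (G □ H)) where

    d-□ : ∀ u x v y → d (G □ H) c (u , x) (v , y) ≡ d G cG u v + d H cH x y
    d-□ u x v y = IsDistance-unique (G □ H)
      (proj₂ (distance (G □ H) c (u , x) (v , y)))
      (□-IsDistance (proj₂ (distance G cG u v)) (proj₂ (distance H cH x y)))

    Tr-□ : ∀ u x → Tr (G □ H) c (u , x) ≡ order H * Tr G cG u + order G * Tr H cH x
    Tr-□ u x = begin
      Tr (G □ H) c (u , x)
        ≡⟨ sum-remQuot (order G) (λ (i , j) → d (G □ H) c (u , x) (G.vertex i , H.vertex j)) ⟩
      sum (λ i → sum (λ j → d (G □ H) c (u , x) (G.vertex i , H.vertex j)))
        ≡⟨ sum-cong-≗ (λ i → sum-cong-≗ (λ j → d-□ u x (G.vertex i) (H.vertex j))) ⟩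
      sum (λ i → sum (λ j → d G cG u (G.vertex i) + d H cH x (H.vertex j)))
        ≡⟨ sum-⊕ (λ i → d G cG u (G.vertex i)) (λ j → d H cH x (H.vertex j)) ⟩
      order H * Tr G cG u + order G * Tr H cH x ∎
      where open ≡-Reasoning

    Tr-□-≡[mod]ˡ : Coprime (order G) (order H) → ∀ {u x v y} →
      Tr (G □ H) c (u , x) ≡ Tr (G □ H) c (v , y) [mod order G ] →
      Tr G cG u ≡ Tr G cG v [mod order G ]
    Tr-□-≡[mod]ˡ g⊥h {u} {x} {v} {y} eq =
      mod-linear {a = Tr G cG u} {Tr G cG v} {Tr H cH x} {Tr H cH y} g⊥h
        (subst₂ (_≡_[mod order G ]) (Tr-□ u x) (Tr-□ v y) eq)

    Tr-□-≡[mod]ʳ : Coprime (order G) (order H) → ∀ {u x v y} →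
      Tr (G □ H) c (u , x) ≡ Tr (G □ H) c (v , y) [mod order H ] →
      Tr H cH x ≡ Tr H cH y [mod order H ]
    Tr-□-≡[mod]ʳ g⊥h {u} {x} {v} {y} eq =
      mod-linear {a = Tr H cH x} {Tr H cH y} {Tr G cG u} {Tr G cG v} (coprime-sym g⊥h)
        (subst₂ (_≡_[mod order H ]) (Tr-□′ u x) (Tr-□′ v y) eq)
      where
      -- The multiple of the modulus, now `order H`, has to be the second summand.
      Tr-□′ : ∀ u x → Tr (G □ H) c (u , x) ≡ order G * Tr H cH x + order H * Tr G cG u
      Tr-□′ u x = trans (Tr-□ u x) (+-comm (order H * Tr G cG u) _)

    Tr-□-injectiveʳ : ∀ {u x y} → Tr (G □ H) c (u , x) ≡ Tr (G □ H) c (u , y) →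
                      Tr H cH x ≡ Tr H cH y
    Tr-□-injectiveʳ {u} {x} {y} eq = *-cancelˡ-≡ _ _ (order G)
      (+-cancelˡ-≡ (order H * Tr G cG u) _ _ (trans (sym (Tr-□ u x)) (trans eq (Tr-□ u y))))
      where
      -- Cancelling `order G` needs it positive; the vertex `u` witnesses this.
      instance
        nonZero : NonZero (order G)
        nonZero = nonZeroIndex (G.index u)

theorem2 : (G H : Graph) → ModuloTransmissionIrregular G → Connected H →
    Coprime (order G) (order H) →
    (TransmissionIrregular H → TransmissionIrregular (G □ H)) ×
    (ModuloTransmissionIrregular H → ModuloTransmissionIrregular (G □ H))
theorem2 G H (cG , mtiG) _ g⊥h = ti , mti
  where
  module G = Graph G

  first-coordinate : (cH : Connected H) → let c = □-connected G H cG cH in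
    ∀ {u x v y} → Tr (G □ H) c (u , x) ≡ Tr (G □ H) c (v , y) [mod order G ] → u ≡ v
  -- Irregularity only refutes `u ≢ v`; decidable equality of vertices yields `u ≡ v`.
  first-coordinate cH {u} {x} {v} {y} eq = decidable-stable (u G.≟ v) λ u≢v →
    mtiG u v u≢v (Tr-□-≡[mod]ˡ G H cG cH (□-connected G H cG cH) g⊥h {u} {x} {v} {y} eq)

  ti : TransmissionIrregular H → TransmissionIrregular (G □ H)
  ti (cH , tiH) = c , irregular
    where
    c = □-connected G H cG cH

    irregular : ∀ p q → p ≢ q → Tr (G □ H) c p ≢ Tr (G □ H) c q
    irregular (u , x) (v , y) p≢q eq
      -- Equal transmissions are congruent modulo `order G`, so the pairs can differ only in the
      -- second coordinate.
      with refl ← first-coordinate cH {u} {x} {v} {y} (mod-reflexive eq) =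
      tiH x y (p≢q ∘ cong (u ,_)) (Tr-□-injectiveʳ G H cG cH c eq)

  mti : ModuloTransmissionIrregular H → ModuloTransmissionIrregular (G □ H)
  mti (cH , mtiH) = c , λ (u , x) (v , y) p≢q eq →
    mtiH x y
      (λ x≡y → p≢q (cong₂ _,_
        -- A congruence modulo the product of the orders holds modulo each factor.
        (first-coordinate cH {u} {x} {v} {y} (∣-trans (m∣m*n (order H)) eq)) x≡y))
      (Tr-□-≡[mod]ʳ G H cG cH c g⊥h {u} {x} {v} {y} (∣-trans (n∣m*n (order G)) eq))
    where
    c = □-connected G H cG cH
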